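{- Let $n,k$ be positive integers with $1\le n\le 2k$ and let $p=\lceil n/k\rceil$ (so $p\le 2$). Then: (a) $\mathrm{op}(n,k)=\mathrm{opt}(n,k)=\mathrm{constr}(n,k)$. (b) For every (not necessarily optimal) $(n,k)$-generator $\mathcal G$, $|\mathcal G^i|\ge \mathrm{constr}^i(n,k)$ for all $i=1,\dots,p$. (c) For every (not necessarily optimal) $(n,k)$-generator $\mathcal G$, there exists $z\in[n]$ such that $|\{g\in\mathcal G: z\in g\}|\ge 2^{p-1}$. (d) An $(n,k)$-generator $\mathcal G$ is optimal if and only if it consists of all the singletons $\{1\},\dots,\{n\}$ together with exactly $\max(n-k,0)$ further sets, which are pairwise disjoint and each of size at least $2$.
   Context: $[n]=\{1,\dots,n\}$. For positive integers $n,k$, an $(n,k)$-generator is a family $\mathcal G$ of subsets of $[n]$ such that every non-empty subset of $[n]$ is a disjoint union of at most $k$ members of $\mathcal G$. $\mathrm{opt}(n,k)$ is the minimum of $|\mathcal G|$ over all $(n,k)$-generators, and a generator is optimal if it attains this minimum. $\mathrm{op}(n,k)$ is the minimum size of a family $\mathcal G$ of subsets of $[n]$ such that every non-empty subset of $[n]$ is a (not necessarily disjoint) union of at most $k$ members of $\mathcal G$. Let $p=\lceil n/k\rceil$ and $n=pk-r$ with $0\le r<k$. Let $V_1,\dots,V_k$ be pairwise disjoint sets with union $[n]$, $r$ of them of size $p-1$ (possibly empty) and $k-r$ of them of size $p$. Then $\mathrm{Constr}(n,k):=(\mathcal P(V_1)\cup\dots\cup\mathcal P(V_k))\setminus\{\emptyset\}$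 and $\mathrm{constr}(n,k):=|\mathrm{Constr}(n,k)|=r(2^{p-1}-1)+(k-r)(2^p-1)$. For a family $\mathcal G$ of subsets of $[n]$, $\mathcal G^i:=\{g\in\mathcal G:|g|\ge i\}$, and $\mathrm{constr}^i(n,k):=|\{g\in \mathrm{Constr}(n,k): |g|\ge i\}|$. -}

module Defs where

open import Data.Nat using (ℕ; zero; suc; _+_; _*_; _∸_; _/_; _%_; _≤_; _≤?_; _≟_; NonZero; s≤s⁻¹)
open import Data.Nat.Properties
  using (+-assoc; *-zeroʳ; *-suc; m+[n∸m]≡n; m+n∸m≡n; m∸n≤m; +-∸-assoc; 1+n≢n; ≤-trans; +-monoˡ-≤; +-cancelʳ-≡)
open import Data.Nat.DivMod using (m≡m%n+[m/n]*n; m%n<n; m≥n⇒m/n>0)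
open import Data.Nat.Solver using (module +-*-Solver)
open import Data.Fin using (Fin)
open import Data.Fin.Subset
open import Data.Fin.Subset.Properties
  using (nonempty?; _⊆?_; _∈?_; ∣⊥∣≡0; ∉⊥; ∪-identityˡ; ∪-identityʳ; ∩-zeroˡ; ∩-zeroʳ)
open import Data.List using (List; []; _∷_; length; filter; map; _++_; allFin)
open import Data.List.Membership.Propositional using () renaming (_∈_ to _∈ˡ_)
open import Data.List.Membership.Propositional.Properties using (∈-map⁻)
open import Data.List.Relation.Unary.All using (All)
open import Data.List.Relation.Unary.AllPairs using (AllPairs)
import Data.List.Relation.Unary.AllPairs as AllPairs
import Data.List.Relation.Unary.All as All
open import Data.List.Relation.Unary.Unique.Propositional using (Unique)
open import Data.List.Relation.Unary.Unique.Propositional.Properties using (map⁺; ++⁺; filter⁺)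
open import Data.List.Relation.Binary.Permutation.Propositional using (_↭_)
open import Data.Product using (Σ; ∃-syntax; _×_; _,_)
open import Data.Vec using (Vec; count; toList)
import Data.Vec as V
open import Data.Vec.Properties using (∷-injectiveʳ; zipWith-++; map-∘; map-cong)
import Data.Vec.Relation.Unary.All as VAll
import Data.Vec.Relation.Unary.All.Properties as VAllP
import Data.Vec.Relation.Unary.Any as VAny
import Data.Vec.Relation.Unary.AllPairs as VAllPairs
import Data.Vec.Relation.Unary.AllPairs.Properties as VAllPairsP
open import Relation.Nullary.Decidable using (_×-dec_; dec-true; dec-false)
open import Relation.Unary using (Pred; Decidable)
open import Relation.Binary.PropositionalEquality
  using (_≡_; _≢_; refl; sym; ≢-sym; trans; cong; cong₂; module ≡-Reasoning)

-- [n] is represented by Fin n.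

record Family (n : ℕ) : Set where
  constructor family
  field
    members : List (Subset n)
    unique  : Unique members

open Family public

size : ∀ {n} → Family n → ℕ
size G = length (members G)

restrict : ∀ {n p} {P : Pred (Subset n) p} → Decidable P → Family n → Family n
restrict P? (family gs u) = family (filter P? gs) (filter⁺ P? u)

-- 𝒢ⁱ
atLeast : ∀ {n} → ℕ → Family n → Family n
atLeast i = restrict (λ g → i ≤? ∣ g ∣)

containing : ∀ {n} → Fin n → Family n → Family n
containing z = restrict (z ∈?_)

Disjoint : ∀ {n} → Subset n → Subset n → Set
Disjoint p q = Empty (p ∩ q)

-- The list in the next two definitions may only repeat a member in ways that
-- do not matter: in the disjoint case only ⊥ can be repeated, and in general
-- deleting a repetition changes neither the union nor the bound.

IsUnionOf≤ : ∀ {n} → ℕ → Family n → Subset n → Set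
IsUnionOf≤ {n} k G s = Σ (List (Subset n)) λ gs →
  All (_∈ˡ members G) gs × length gs ≤ k × ⋃ gs ≡ s

IsDisjointUnionOf≤ : ∀ {n} → ℕ → Family n → Subset n → Set
IsDisjointUnionOf≤ {n} k G s = Σ (List (Subset n)) λ gs →
  All (_∈ˡ members G) gs × length gs ≤ k × AllPairs Disjoint gs × ⋃ gs ≡ s

IsGenerator : ∀ {n} → ℕ → Family n → Set
IsGenerator k G = ∀ s → Nonempty s → IsDisjointUnionOf≤ k G s

IsUnionGenerator : ∀ {n} → ℕ → Family n → Set
IsUnionGenerator k G = ∀ s → Nonempty s → IsUnionOf≤ k G s

IsMinSize : ∀ {n} → (Family n → Set) → ℕ → Set
IsMinSize {n} P m = (Σ (Family n) λ G → P G × size G ≡ m) × (∀ G → P G → m ≤ size G)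

op[_,_]≡_ : ℕ → ℕ → ℕ → Set
op[ n , k ]≡ m = IsMinSize {n} (IsUnionGenerator k) m

opt[_,_]≡_ : ℕ → ℕ → ℕ → Set
opt[ n , k ]≡ m = IsMinSize {n} (IsGenerator k) m

IsOptimal : ∀ {n} → ℕ → Family n → Set
IsOptimal {n} k G = IsGenerator k G × opt[ n , k ]≡ size G

⌈_/_⌉ : (n k : ℕ) .{{_ : NonZero k}} → ℕ
⌈ n / k ⌉ = (n + (k ∸ 1)) / k

-- The r with n = pk - r for p = ⌈n/k⌉.
defect : (n k : ℕ) .{{_ : NonZero k}} → ℕ
defect n k = ⌈ n / k ⌉ * k ∸ n

-- r + (k - r) = k, so the last two fields account for the size of every part.
record IsBalancedPartition {n} (k : ℕ) .{{_ : NonZero k}} (V : Vec (Subset n) k) : Set where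
  field
    disjoint : VAllPairs.AllPairs Disjoint V
    covers   : ⋃ (toList V) ≡ ⊤
    small    : count (_≟ ⌈ n / k ⌉ ∸ 1) (V.map ∣_∣ V) ≡ defect n k
    large    : count (_≟ ⌈ n / k ⌉) (V.map ∣_∣ V) ≡ k ∸ defect n k

allSubsets : ∀ n → List (Subset n)
allSubsets zero    = V.[] ∷ []
allSubsets (suc n) = map (inside V.∷_) (allSubsets n) ++ map (outside V.∷_) (allSubsets n)

allSubsets-unique : ∀ n → Unique (allSubsets n)
allSubsets-unique zero    = All.[] AllPairs.∷ AllPairs.[]
allSubsets-unique (suc n) =
  ++⁺ (map⁺ ∷-injectiveʳ (allSubsets-unique n)) (map⁺ ∷-injectiveʳ (allSubsets-unique n)) disj
  where
  disj : ∀ {v} → v ∈ˡ map (inside V.∷_) (allSubsets n) ×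
                 v ∈ˡ map (outside V.∷_) (allSubsets n) → _
  disj (p , q) with ∈-map⁻ _ p | ∈-map⁻ _ q
  ... | _ , _ , refl | _ , _ , ()

powerset : ∀ n → Family n
powerset n = family (allSubsets n) (allSubsets-unique n)

Constr : ∀ {n k} → Vec (Subset n) k → Family n
Constr {n} V = restrict (λ g → nonempty? g ×-dec VAny.any? (g ⊆?_) V) (powerset n)

constr : ∀ {n k} → Vec (Subset n) k → ℕ
constr V = size (Constr V)

constrAtLeast : ∀ {n k} → ℕ → Vec (Subset n) k → ℕ
constrAtLeast i V = size (atLeast i (Constr V))

ConsistsOfSingletonsAnd : ∀ {n} → Family n → List (Subset n) → Set
ConsistsOfSingletonsAnd {n} G F = members G ↭ map ⁅_⁆ (allFin n) ++ F

-- Balanced partitions exist: cut [n] into consecutive intervals.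

private
  intervals : ∀ {m} (ss : Vec ℕ m) → Vec (Subset (V.sum ss)) m
  intervals V.[]       = V.[]
  intervals (s V.∷ ss) = (⊤ {s} V.++ ⊥) V.∷ V.map (⊥ {s} V.++_) (intervals ss)

  ⊥-++ : ∀ a {b} → ⊥ {a} V.++ ⊥ {b} ≡ ⊥
  ⊥-++ zero    = refl
  ⊥-++ (suc a) = cong (outside V.∷_) (⊥-++ a)

  ⊤-++ : ∀ a {b} → ⊤ {a} V.++ ⊤ {b} ≡ ⊤
  ⊤-++ zero    = refl
  ⊤-++ (suc a) = cong (inside V.∷_) (⊤-++ a)

  ∣⊥++∣ : ∀ a {b} (q : Subset b) → ∣ ⊥ {a} V.++ q ∣ ≡ ∣ q ∣
  ∣⊥++∣ zero    q = refl
  ∣⊥++∣ (suc a) q = ∣⊥++∣ a q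

  ∣⊤++∣ : ∀ a {b} → ∣ ⊤ {a} V.++ ⊥ {b} ∣ ≡ a
  ∣⊤++∣ zero {b} = ∣⊥∣≡0 b
  ∣⊤++∣ (suc a)  = cong suc (∣⊤++∣ a)

  empty : ∀ {n} {p : Subset n} → p ≡ ⊥ → Empty p
  empty refl (_ , x∈⊥) = ∉⊥ x∈⊥

  disjoint-⊤⊥ : ∀ a {b} (q : Subset b) → Disjoint (⊤ {a} V.++ ⊥) (⊥ {a} V.++ q)
  disjoint-⊤⊥ a q = empty (trans (zipWith-++ _ (⊤ {a}) ⊥ ⊥ q)
    (trans (cong₂ V._++_ (∩-zeroʳ _) (∩-zeroˡ q)) (⊥-++ a)))

  shift-disjoint : ∀ a {b} {p q : Subset b} → Disjoint p q → Disjoint (⊥ {a} V.++ p) (⊥ {a} V.++ q)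
  shift-disjoint zero    d = d
  shift-disjoint (suc a) d (_ , V.there x∈) = shift-disjoint a d (_ , x∈)

  intervals-disjoint : ∀ {m} (ss : Vec ℕ m) → VAllPairs.AllPairs Disjoint (intervals ss)
  intervals-disjoint V.[]       = VAllPairs.[]
  intervals-disjoint (s V.∷ ss) =
    VAllP.map⁺ (VAll.universal (disjoint-⊤⊥ s) (intervals ss)) VAllPairs.∷
    VAllPairsP.map⁺ (VAllPairs.map (shift-disjoint s) (intervals-disjoint ss))

  ⋃-shift : ∀ a {b m} (qs : Vec (Subset b) m) →
            ⋃ (toList (V.map (⊥ {a} V.++_) qs)) ≡ ⊥ {a} V.++ ⋃ (toList qs)
  ⋃-shift a V.[]       = sym (⊥-++ a)
  ⋃-shift a (q V.∷ qs) = trans (cong ((⊥ {a} V.++ q) ∪_) (⋃-shift a qs))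
    (trans (zipWith-++ _ (⊥ {a}) q ⊥ _) (cong (V._++ (q ∪ ⋃ (toList qs))) (∪-identityˡ ⊥)))

  intervals-cover : ∀ {m} (ss : Vec ℕ m) → ⋃ (toList (intervals ss)) ≡ ⊤
  intervals-cover V.[]       = refl
  intervals-cover (s V.∷ ss) = trans (cong ((⊤ {s} V.++ ⊥) ∪_) (⋃-shift s (intervals ss)))
    (trans (zipWith-++ _ (⊤ {s}) ⊥ ⊥ _)
    (trans (cong₂ V._++_ (∪-identityʳ ⊤) (trans (∪-identityˡ _) (intervals-cover ss))) (⊤-++ s)))

  intervals-sizes : ∀ {m} (ss : Vec ℕ m) → V.map ∣_∣ (intervals ss) ≡ ss
  intervals-sizes V.[]       = refl
  intervals-sizes (s V.∷ ss) = cong₂ V._∷_ (∣⊤++∣ s)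
    (trans (sym (map-∘ ∣_∣ (⊥ {s} V.++_) (intervals ss)))
    (trans (map-cong (∣⊥++∣ s) (intervals ss)) (intervals-sizes ss)))

  sizes : (r t q : ℕ) → Vec ℕ (r + t)
  sizes r t q = V.replicate r q V.++ V.replicate t (suc q)

  count-hit : ∀ x {m} (ys : Vec ℕ m) → count (_≟ x) (x V.∷ ys) ≡ suc (count (_≟ x) ys)
  count-hit x ys rewrite dec-true (x ≟ x) refl = refl

  count-miss : ∀ {x y} → y ≢ x → ∀ {m} (ys : Vec ℕ m) → count (_≟ x) (y V.∷ ys) ≡ count (_≟ x) ys
  count-miss {x} {y} y≢x ys rewrite dec-false (y ≟ x) y≢x = refl

  sizes-small : ∀ r t q → count (_≟ q) (sizes r t q) ≡ r
  sizes-small zero    zero    q = refl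
  sizes-small zero    (suc t) q = trans (count-miss 1+n≢n (sizes 0 t q)) (sizes-small zero t q)
  sizes-small (suc r) t       q = trans (count-hit q (sizes r t q)) (cong suc (sizes-small r t q))

  sizes-large : ∀ r t q → count (_≟ suc q) (sizes r t q) ≡ t
  sizes-large zero    zero    q = refl
  sizes-large zero    (suc t) q = trans (count-hit (suc q) (sizes 0 t q)) (cong suc (sizes-large zero t q))
  sizes-large (suc r) t       q = trans (count-miss (≢-sym 1+n≢n) (sizes r t q)) (sizes-large r t q)

  sizes-sum : ∀ r t q → V.sum (sizes r t q) + r ≡ suc q * (r + t)
  sizes-sum zero zero q = sym (*-zeroʳ q)
  sizes-sum zero (suc t) q = trans (+-assoc (suc q) (V.sum (sizes 0 t q)) 0)
    (trans (cong (suc q +_) (sizes-sum zero t q)) (sym (*-suc (suc q) t)))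
  sizes-sum (suc r) t q = trans
    (solve 3 (λ q s r → (q :+ s) :+ (con 1 :+ r) := (con 1 :+ q) :+ (s :+ r)) refl q (V.sum (sizes r t q)) r)
    (trans (cong (suc q +_) (sizes-sum r t q)) (sym (*-suc (suc q) (r + t))))
    where open +-*-Solver

  fromSizes : ∀ {n k m} .{{_ : NonZero k}} (ss : Vec ℕ m) → m ≡ k → V.sum ss ≡ n →
    count (_≟ ⌈ n / k ⌉ ∸ 1) ss ≡ defect n k → count (_≟ ⌈ n / k ⌉) ss ≡ k ∸ defect n k →
    Σ (Vec (Subset n) k) (IsBalancedPartition k)
  fromSizes ss refl refl sm lg = intervals ss , record
    { disjoint = intervals-disjoint ss
    ; covers   = intervals-cover ss
    ; small    = trans (cong (count _) (intervals-sizes ss)) sm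
    ; large    = trans (cong (count _) (intervals-sizes ss)) lg
    }

  -- n + r = pk with r ≤ k - 1
  ceiling : ∀ n k .{{_ : NonZero k}} → ∃[ r ] (r ≤ k ∸ 1) × (n + r ≡ ⌈ n / k ⌉ * k)
  ceiling n (suc j) = j ∸ x , m∸n≤m j x , (begin
    n + (j ∸ x)                ≡⟨ +-∸-assoc n x≤j ⟨
    n + j ∸ x                  ≡⟨ cong (_∸ x) (m≡m%n+[m/n]*n (n + j) (suc j)) ⟩
    x + ⌈ n / suc j ⌉ * suc j ∸ x ≡⟨ m+n∸m≡n x _ ⟩
    ⌈ n / suc j ⌉ * suc j ∎)
    where
    open ≡-Reasoning
    x : ℕ
    x = (n + j) % suc j
    x≤j : x ≤ j
    x≤j = s≤s⁻¹ (m%n<n (n + j) (suc j))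

  fromRemainder : ∀ n k .{{_ : NonZero k}} q r → ⌈ n / k ⌉ ≡ suc q → r ≤ k →
                  n + r ≡ suc q * k → Σ (Vec (Subset n) k) (IsBalancedPartition k)
  fromRemainder n k q r p≡ r≤k eq = fromSizes (sizes r (k ∸ r) q) r+t≡k
    (+-cancelʳ-≡ r _ n (trans (sizes-sum r (k ∸ r) q) (trans (cong (suc q *_) r+t≡k) (sym eq))))
    (trans (cong (λ p → count (_≟ p ∸ 1) (sizes r (k ∸ r) q)) p≡) (trans (sizes-small r (k ∸ r) q) (sym defect≡r)))
    (trans (cong (λ p → count (_≟ p) (sizes r (k ∸ r) q)) p≡) (trans (sizes-large r (k ∸ r) q) (cong (k ∸_) (sym defect≡r))))
    where
    r+t≡k : r + (k ∸ r) ≡ k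
    r+t≡k = m+[n∸m]≡n r≤k
    defect≡r : defect n k ≡ r
    defect≡r = trans (cong (λ p → p * k ∸ n) p≡) (trans (cong (_∸ n) (sym eq)) (m+n∸m≡n n r))

  ceiling>0 : ∀ n k .{{_ : NonZero k}} → 1 ≤ n → 1 ≤ ⌈ n / k ⌉
  ceiling>0 n k@(suc j) 1≤n = m≥n⇒m/n>0 {n + j} {k} (+-monoˡ-≤ j 1≤n)

balancedPartition : ∀ n k .{{_ : NonZero k}} → 1 ≤ n → Σ (Vec (Subset n) k) (IsBalancedPartition k)
balancedPartition n k 1≤n with ceiling n k
... | r , r≤k-1 , eq =
  fromRemainder n k (⌈ n / k ⌉ ∸ 1) r (sym p≡) (≤-trans r≤k-1 (m∸n≤m k 1))
    (trans eq (cong (_* k) (sym p≡)))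
  where
  p≡ : suc (⌈ n / k ⌉ ∸ 1) ≡ ⌈ n / k ⌉
  p≡ = m+[n∸m]≡n (ceiling>0 n k 1≤n)

{-# OPTIONS --safe #-}

-- Every member of size ≥ 2 is hit by some set T of points with at most one point
-- per such member.  The complement of T contains no member of size ≥ 2, so it is
-- a union of at most k sets of size ≤ 1, and n ≤ k + |T|.  Hence a generator has
-- at least n - k members of size ≥ 2 besides the n singletons.  If there are only
-- n - k of them and two meet, a common point gives a smaller T: a contradiction.
-- For the upper bound, the parts have size at most 2, so a member of Constr with
-- at least two elements is one of the n - k parts of size 2.

module Submission where

open import Defs
open import Data.Nat using (ℕ; suc; _+_; _*_; _∸_; _^_; _/_; _≤_; _<_; _≤?_; _≟_; z≤n; s≤s; s≤s⁻¹; NonZero)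
open import Data.Nat.Properties
open import Data.Nat.DivMod using (m<n⇒m/n≡0; m/n≡1+[m∸n]/n)
open import Data.Bool using (true; false)
open import Data.Fin using (Fin; zero)
open import Data.Fin.Subset
open import Data.Fin.Subset.Properties
open import Data.List using (List; []; _∷_; [_]; length; map; filter; allFin; _++_)
open import Data.List.Properties using (++-identityʳ; length-++; length-map; length-tabulate; length-filter; filter-none)
open import Data.List.Membership.Propositional using (find; lose) renaming (_∈_ to _∈ˡ_)
open import Data.List.Membership.Propositional.Properties
  using (∈-∃++; ∈-map⁺; ∈-map⁻; ∈-++⁺ˡ; ∈-++⁺ʳ; ∈-++⁻; ∈-filter⁺; ∈-filter⁻; ∈-allFin)
open import Data.List.Relation.Binary.Permutation.Propositional using (_↭_; ↭-refl; ↭-sym; ↭-trans; prep; ↭-reflexive)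
open import Data.List.Relation.Binary.Permutation.Propositional.Properties using (↭-length; ∈-resp-↭; shift; All-resp-↭)
open import Data.List.Relation.Binary.Subset.Propositional using () renaming (_⊆_ to _⊆ˡ_)
open import Data.List.Relation.Unary.All as All using (All; []; _∷_)
import Data.List.Relation.Unary.All.Properties as AllP
open import Data.List.Relation.Unary.Any using (Any; here; there)
open import Data.List.Relation.Unary.AllPairs using (AllPairs; []; _∷_)
import Data.List.Relation.Unary.AllPairs as AllPairs
import Data.List.Relation.Unary.AllPairs.Properties as AllPairsP
open import Data.List.Relation.Unary.Unique.Propositional using (Unique)
open import Data.List.Relation.Unary.Unique.Propositional.Properties using (map⁺; ++⁺; allFin⁺)
open import Data.Vec as V using (Vec; []; _∷_; toList; count)
open import Data.Vec.Properties using (length-toList)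
open import Data.Vec.Relation.Unary.All as VAll using ([]; _∷_)
import Data.Vec.Relation.Unary.All.Properties as VAllP
import Data.Vec.Relation.Unary.Any as VAny
import Data.Vec.Relation.Unary.Any.Properties as VAnyP
import Data.Vec.Relation.Unary.AllPairs as VAllPairs
open import Data.Product using (∃; ∃-syntax; _×_; _,_; proj₁)
open import Data.Sum using (_⊎_; inj₁; inj₂)
open import Function using (_∘_)
open import Function.Bundles using (_⇔_; mk⇔)
open import Level using (0ℓ)
open import Relation.Nullary using (yes; no; ¬_; contradiction)
open import Relation.Nullary.Decidable using (_×-dec_)
open import Relation.Unary using (Pred; Decidable)
open import Relation.Binary using (Rel)
open import Relation.Binary.PropositionalEquality
  using (_≡_; _≢_; refl; sym; trans; cong; cong₂; subst)

-- Lists and vectors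

-- Each element of `xs` is pulled to the front of `ys` in turn. Since `xs` has no repetition, its
-- other elements survive in what remains of `ys`, so the induction goes on. `zs` is the leftover,
-- and counting it gives the cardinality facts that follow.
unique-⊆⇒↭ : ∀ {A : Set} {xs ys : List A} → Unique xs → xs ⊆ˡ ys → ∃[ zs ] ys ↭ xs ++ zs
unique-⊆⇒↭ {ys = ys} []              xs⊆ys = ys , ↭-refl
unique-⊆⇒↭ {xs = x ∷ xs} (x∉xs ∷ u) xs⊆ys with ∈-∃++ (xs⊆ys (here refl))
... | as , bs , refl = let zs , p = unique-⊆⇒↭ u xs⊆ in zs , ↭-trans (shift x as bs) (prep x p)
  where
  xs⊆ : xs ⊆ˡ as ++ bs
  xs⊆ y∈xs with ∈-resp-↭ (shift x as bs) (xs⊆ys (there y∈xs))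
  ... | here refl = contradiction refl (All.lookup x∉xs y∈xs)
  ... | there y∈  = y∈

unique-⊆⇒length-≤ : ∀ {A : Set} {xs ys : List A} → Unique xs → xs ⊆ˡ ys → length xs ≤ length ys
unique-⊆⇒length-≤ {xs = xs} u xs⊆ys = let zs , p = unique-⊆⇒↭ u xs⊆ys in
  ≤-trans (m≤m+n (length xs) (length zs)) (≤-reflexive (sym (trans (↭-length p) (length-++ xs))))

unique-⊆-full⇒↭ : ∀ {A : Set} {xs ys : List A} → Unique xs → xs ⊆ˡ ys → length ys ≤ length xs → ys ↭ xs
unique-⊆-full⇒↭ {xs = xs} u xs⊆ys ys≤xs with unique-⊆⇒↭ u xs⊆ys
... | []     , p = ↭-trans p (↭-reflexive (++-identityʳ xs))
... | z ∷ zs , p = contradiction ys≤xs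
  (<⇒≱ (<-≤-trans (m<m+n (length xs) (s≤s z≤n)) (≤-reflexive (sym (trans (↭-length p) (length-++ xs))))))

length>0⇒∃∈ : ∀ {A : Set} (xs : List A) → 1 ≤ length xs → ∃[ x ] x ∈ˡ xs
length>0⇒∃∈ (x ∷ _) _ = x , here refl

toList-AllPairs : ∀ {A : Set} {R : Rel A 0ℓ} {m} {xs : Vec A m} → VAllPairs.AllPairs R xs → AllPairs R (toList xs)
toList-AllPairs VAllPairs.[]       = []
toList-AllPairs (px VAllPairs.∷ p) = VAllP.toList⁺ px ∷ toList-AllPairs p

module _ {A : Set} {P Q : Pred A 0ℓ} (P? : Decidable P) (Q? : Decidable Q) (disj : ∀ {x} → P x → ¬ Q x) where

  count-disjoint : ∀ {m} (xs : Vec A m) → count P? xs + count Q? xs ≤ m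
  count-disjoint [] = z≤n
  count-disjoint (x ∷ xs) with P? x | Q? x
  ... | yes p | yes q = contradiction q (disj p)
  ... | yes _ | no  _ = s≤s (count-disjoint xs)
  ... | no  _ | yes _ = ≤-trans (≤-reflexive (+-suc _ _)) (s≤s (count-disjoint xs))
  ... | no  _ | no  _ = m≤n⇒m≤1+n (count-disjoint xs)

  -- Pigeonhole: the predicates exclude each other, so each of the `m` entries is counted at most
  -- once, and counts adding up to `m` leave no entry uncounted. This recovers the size of every
  -- part from the two counts of a balanced partition.
  count-full⇒All : ∀ {m} (xs : Vec A m) → m ≤ count P? xs + count Q? xs → VAll.All (λ x → P x ⊎ Q x) xs
  count-full⇒All [] _ = []
  count-full⇒All (x ∷ xs) full with P? x | Q? x
  ... | yes p | yes q = contradiction q (disj p)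
  ... | yes p | no  _ = inj₁ p ∷ count-full⇒All xs (s≤s⁻¹ full)
  ... | no  _ | yes q = inj₂ q ∷ count-full⇒All xs (s≤s⁻¹ (≤-trans full (≤-reflexive (+-suc _ _))))
  ... | no  _ | no  _ = contradiction full (<⇒≱ (s≤s (count-disjoint xs)))

length-filter≤count : ∀ {A B : Set} {P : Pred A 0ℓ} {Q : Pred B 0ℓ} (P? : Decidable P) (Q? : Decidable Q) (f : A → B) →
  ∀ {m} {xs : Vec A m} → VAll.All (λ x → P x → Q (f x)) xs → length (filter P? (toList xs)) ≤ count Q? (V.map f xs)
length-filter≤count P? Q? f [] = z≤n
length-filter≤count P? Q? f {xs = x ∷ xs} (h ∷ hs) with P? x | Q? (f x)
... | yes _ | yes _ = s≤s (length-filter≤count P? Q? f hs)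
... | yes p | no ¬q = contradiction (h p) ¬q
... | no  _ | yes _ = m≤n⇒m≤1+n (length-filter≤count P? Q? f hs)
... | no  _ | no  _ = length-filter≤count P? Q? f hs

-- Subsets

module _ {n : ℕ} where

  ∈-⋃⁺ : ∀ {g : Subset n} {gs} → g ∈ˡ gs → g ⊆ ⋃ gs
  ∈-⋃⁺ {gs = g ∷ gs} (here refl) = p⊆p∪q (⋃ gs)
  ∈-⋃⁺ {gs = g ∷ gs} (there g∈)  = q⊆p∪q g (⋃ gs) ∘ ∈-⋃⁺ g∈

  ∈-⋃⁻ : ∀ {x} (gs : List (Subset n)) → x ∈ ⋃ gs → ∃[ g ] g ∈ˡ gs × x ∈ g
  ∈-⋃⁻ []       x∈ = contradiction x∈ ∉⊥
  ∈-⋃⁻ (g ∷ gs) x∈ with x∈p∪q⁻ g (⋃ gs) x∈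
  ... | inj₁ x∈g  = g , here refl , x∈g
  ... | inj₂ x∈gs = let h , h∈ , x∈h = ∈-⋃⁻ gs x∈gs in h , there h∈ , x∈h

  ⊆∧∣∣≥⇒≡ : {p q : Subset n} → p ⊆ q → ∣ q ∣ ≤ ∣ p ∣ → p ≡ q
  ⊆∧∣∣≥⇒≡ {p} {q} p⊆q ∣q∣≤∣p∣ = ⊆-antisym p⊆q q⊆p
    where
    q⊆p : q ⊆ p
    q⊆p {x} x∈q with x ∈? p
    ... | yes x∈p = x∈p
    ... | no  x∉p = contradiction ∣q∣≤∣p∣ (<⇒≱ (p⊂q⇒∣p∣<∣q∣ (p⊆q , x , x∈q , x∉p)))

  x∈p⇒⁅x⁆⊆p : ∀ {x} {p : Subset n} → x ∈ p → ⁅ x ⁆ ⊆ p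
  x∈p⇒⁅x⁆⊆p {x} x∈p y∈ = subst (_∈ _) (sym (x∈⁅y⁆⇒x≡y x y∈)) x∈p

  ∣p∣>0⇒nonempty : {p : Subset n} → 1 ≤ ∣ p ∣ → Nonempty p
  ∣p∣>0⇒nonempty {p} ∣p∣>0 with nonempty? p
  ... | yes ne = ne
  ... | no  e  = contradiction (trans (cong ∣_∣ (Empty-unique e)) (∣⊥∣≡0 n)) (>⇒≢ ∣p∣>0)

  ⁅⁆-injective : {x y : Fin n} → ⁅ x ⁆ ≡ ⁅ y ⁆ → x ≡ y
  ⁅⁆-injective {x} {y} eq = x∈⁅y⁆⇒x≡y y (subst (x ∈_) eq (x∈⁅x⁆ x))

  ⁅x⁆≢large : ∀ {x} {h : Subset n} → 2 ≤ ∣ h ∣ → ⁅ x ⁆ ≢ h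
  ⁅x⁆≢large {x} 2≤ refl = contradiction (∣⁅x⁆∣≡1 x) (>⇒≢ 2≤)

∣p∪q∣≤∣p∣+∣q∣ : ∀ {n} (p q : Subset n) → ∣ p ∪ q ∣ ≤ ∣ p ∣ + ∣ q ∣
∣p∪q∣≤∣p∣+∣q∣ []          []          = z≤n
∣p∪q∣≤∣p∣+∣q∣ (true ∷ p)  (true ∷ q)  = s≤s (≤-trans (∣p∪q∣≤∣p∣+∣q∣ p q) (+-monoʳ-≤ ∣ p ∣ (n≤1+n ∣ q ∣)))
∣p∪q∣≤∣p∣+∣q∣ (true ∷ p)  (false ∷ q) = s≤s (∣p∪q∣≤∣p∣+∣q∣ p q)
∣p∪q∣≤∣p∣+∣q∣ (false ∷ p) (true ∷ q)  = ≤-trans (s≤s (∣p∪q∣≤∣p∣+∣q∣ p q)) (≤-reflexive (sym (+-suc ∣ p ∣ ∣ q ∣)))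
∣p∪q∣≤∣p∣+∣q∣ (false ∷ p) (false ∷ q) = ∣p∪q∣≤∣p∣+∣q∣ p q

∣⋃∣≤length : ∀ {n} {gs : List (Subset n)} → All (λ g → ∣ g ∣ ≤ 1) gs → ∣ ⋃ gs ∣ ≤ length gs
∣⋃∣≤length {n} [] = ≤-reflexive (∣⊥∣≡0 n)
∣⋃∣≤length {gs = g ∷ gs} (small ∷ smalls) =
  ≤-trans (∣p∪q∣≤∣p∣+∣q∣ g (⋃ gs)) (+-mono-≤ small (∣⋃∣≤length smalls))

-- Hitting sets

-- Hitting sets are lists of points with repetitions allowed, so that one choice per member has
-- exactly as many entries as there are members.
Hits : ∀ {n} → List (Fin n) → Subset n → Set
Hits T h = Any (_∈ h) T

hittingSet : ∀ {n} {hs : List (Subset n)} → All Nonempty hs → ∃[ T ] length T ≡ length hs × All (Hits T) hs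
hittingSet [] = [] , refl , []
hittingSet ((x , x∈h) ∷ nes) = let T , len , hits = hittingSet nes in
  x ∷ T , cong suc len , here x∈h ∷ All.map there hits

-- If two members share a point, that point serves both, and one point for each other member
-- completes a hitting list one shorter than `hs`.
minimal-hitting⇒disjoint : ∀ {n} {hs : List (Subset n)} → All Nonempty hs →
  (∀ T → All (Hits T) hs → length hs ≤ length T) → AllPairs Disjoint hs
minimal-hitting⇒disjoint [] _ = []
minimal-hitting⇒disjoint {hs = h ∷ hs} ((x , x∈h) ∷ nes) minimal =
  All.tabulate disjoint ∷
  -- The tail inherits minimality: a list that hits the tail, extended by the point `x` of `h`, hits
  -- all of `hs`.
  minimal-hitting⇒disjoint nes λ T hits → s≤s⁻¹ (minimal (x ∷ T) (here x∈h ∷ All.map there hits))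
  where
  disjoint : ∀ {g} → g ∈ˡ hs → Disjoint h g
  disjoint {g} g∈ (y , y∈h∩g) with x∈p∩q⁻ h g y∈h∩g | ∈-∃++ g∈
  ... | y∈h , y∈g | as , bs , refl =
    -- `T` takes one point from each member other than `h` and `g`; the common point `y` takes care
    -- of those two.
    let p = shift g as bs
        T , len , hits = hittingSet (All.tail (All-resp-↭ p nes))
    in contradiction
      (minimal (y ∷ T) (here y∈h ∷ All-resp-↭ (↭-sym p) (here y∈g ∷ All.map there hits)))
      (<⇒≱ (s≤s (≤-reflexive (trans (cong suc len) (sym (↭-length p))))))

-- Generators

singletons : ∀ n → List (Subset n)
singletons n = map ⁅_⁆ (allFin n)

length-singletons-++ : ∀ {n} (F : List (Subset n)) → length (singletons n ++ F) ≡ n + length F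
length-singletons-++ {n} F = trans (length-++ (singletons n))
  (cong (_+ length F) (trans (length-map ⁅_⁆ (allFin n)) (length-tabulate {n = n} (λ x → x))))

generator⇒unionGenerator : ∀ {n k} (G : Family n) → IsGenerator k G → IsUnionGenerator k G
generator⇒unionGenerator G gen s ne = let gs , gs⊆ , len , _ , eq = gen s ne in gs , gs⊆ , len , eq

module _ {n k : ℕ} (G : Family n) (gen : IsUnionGenerator k G) where

  private
    largeMembers : List (Subset n)
    largeMembers = members (atLeast 2 G)

    largeMembers-size : All (λ h → 2 ≤ ∣ h ∣) largeMembers
    largeMembers-size = AllP.all-filter (λ g → 2 ≤? ∣ g ∣) (members G)

    largeMembers-nonempty : All Nonempty largeMembers
    largeMembers-nonempty = All.map (∣p∣>0⇒nonempty ∘ ≤-trans (n≤1+n 1)) largeMembers-size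

  -- Some set in a union equal to `⁅ x ⁆` contains `x`, and being inside the union it can contain
  -- nothing else.
  ⁅x⁆∈generator : ∀ x → ⁅ x ⁆ ∈ˡ members G
  ⁅x⁆∈generator x with gen ⁅ x ⁆ (x , x∈⁅x⁆ x)
  ... | gs , gs⊆ , _ , eq with ∈-⋃⁻ gs (subst (x ∈_) (sym eq) (x∈⁅x⁆ x))
  ... | g , g∈ , x∈g = subst (_∈ˡ members G) g≡⁅x⁆ (All.lookup gs⊆ g∈)
    where
    g≡⁅x⁆ : g ≡ ⁅ x ⁆
    g≡⁅x⁆ = ⊆-antisym (λ y∈g → subst (_ ∈_) eq (∈-⋃⁺ g∈ y∈g)) (x∈p⇒⁅x⁆⊆p x∈g)

  hitting⇒n≤k+∣T∣ : ∀ T → All (Hits T) largeMembers → n ≤ k + length T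
  hitting⇒n≤k+∣T∣ T hits = begin
    n                    ≤⟨ m≤n+m∸n n ∣ U ∣ ⟩
    ∣ U ∣ + (n ∸ ∣ U ∣)    ≡⟨ cong (∣ U ∣ +_) (∣∁p∣≡n∸∣p∣ U) ⟨
    ∣ U ∣ + ∣ ∁ U ∣        ≤⟨ +-mono-≤ ∣U∣≤ ∣∁U∣≤k ⟩
    length T + k         ≡⟨ +-comm (length T) k ⟩
    k + length T         ∎
    where
    open ≤-Reasoning
    U : Subset n
    U = ⋃ (map ⁅_⁆ T)
    -- Only an inequality, since `T` may list a point more than once.
    ∣U∣≤ : ∣ U ∣ ≤ length T
    ∣U∣≤ = ≤-trans (∣⋃∣≤length (AllP.map⁺ (All.universal (λ x → ≤-reflexive (∣⁅x⁆∣≡1 x)) T)))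
                  (≤-reflexive (length-map ⁅_⁆ T))
    small : ∀ {g} → g ∈ˡ members G → g ⊆ ∁ U → ∣ g ∣ ≤ 1
    small {g} g∈G g⊆∁U with 2 ≤? ∣ g ∣
    ... | no  2≰ = s≤s⁻¹ (≰⇒> 2≰)
    ... | yes 2≤ =
      let t , t∈T , t∈g = find (All.lookup hits (∈-filter⁺ (λ h → 2 ≤? ∣ h ∣) g∈G 2≤))
      in contradiction (∈-⋃⁺ (∈-map⁺ ⁅_⁆ t∈T) (x∈⁅x⁆ t)) (x∈∁p⇒x∉p (g⊆∁U t∈g))
    ∣∁U∣≤k : ∣ ∁ U ∣ ≤ k
    ∣∁U∣≤k with nonempty? (∁ U)
    -- Generators say nothing about the empty set, so an empty complement is treated apart.
    ... | no  e  = ≤-trans (≤-reflexive (trans (cong ∣_∣ (Empty-unique e)) (∣⊥∣≡0 n))) z≤n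
    ... | yes ne =
      let gs , gs⊆ , len , eq = gen (∁ U) ne
          smalls = All.tabulate λ g∈ → small (All.lookup gs⊆ g∈) (λ x∈g → subst (_ ∈_) eq (∈-⋃⁺ g∈ x∈g))
      in ≤-trans (≤-reflexive (cong ∣_∣ (sym eq))) (≤-trans (∣⋃∣≤length smalls) len)

  n∸k≤hitting : ∀ T → All (Hits T) largeMembers → n ∸ k ≤ length T
  n∸k≤hitting T hits = m≤n+o⇒m∸n≤o n k (hitting⇒n≤k+∣T∣ T hits)

  n∸k≤largeMembers : n ∸ k ≤ length largeMembers
  n∸k≤largeMembers = let T , len , hits = hittingSet largeMembers-nonempty in
    ≤-trans (n∸k≤hitting T hits) (≤-reflexive len)

  few-large⇒disjoint : length largeMembers ≤ n ∸ k → AllPairs Disjoint largeMembers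
  few-large⇒disjoint few =
    minimal-hitting⇒disjoint largeMembers-nonempty λ T hits → ≤-trans few (n∸k≤hitting T hits)

  singletons-++-largeMembers-unique : Unique (singletons n ++ largeMembers)
  singletons-++-largeMembers-unique = ++⁺ (map⁺ ⁅⁆-injective (allFin⁺ n)) (unique (atLeast 2 G))
    λ (p , q) → let x , _ , eq = ∈-map⁻ ⁅_⁆ p in ⁅x⁆≢large (All.lookup largeMembers-size q) (sym eq)

  -- The target is the family of non-empty members rather than all of `G`, because the bound for
  -- `i = 1` must not count a possible empty member.
  singletons-++-largeMembers-⊆ : singletons n ++ largeMembers ⊆ˡ members (atLeast 1 G)
  singletons-++-largeMembers-⊆ g∈ with ∈-++⁻ (singletons n) g∈
  ... | inj₁ p with ∈-map⁻ ⁅_⁆ p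
  ...   | x , _ , refl = ∈-filter⁺ _ (⁅x⁆∈generator x) (≤-reflexive (sym (∣⁅x⁆∣≡1 x)))
  singletons-++-largeMembers-⊆ g∈ | inj₂ q = let g∈G , 2≤ = ∈-filter⁻ (λ h → 2 ≤? ∣ h ∣) {xs = members G} q in
    ∈-filter⁺ _ g∈G (≤-trans (n≤1+n 1) 2≤)

  n+largeMembers≤atLeast-1 : n + length largeMembers ≤ size (atLeast 1 G)
  n+largeMembers≤atLeast-1 = ≤-trans (≤-reflexive (sym (length-singletons-++ largeMembers)))
    (unique-⊆⇒length-≤ singletons-++-largeMembers-unique singletons-++-largeMembers-⊆)

  n+[n∸k]≤atLeast-1 : n + (n ∸ k) ≤ size (atLeast 1 G)
  n+[n∸k]≤atLeast-1 = ≤-trans (+-monoʳ-≤ n n∸k≤largeMembers) n+largeMembers≤atLeast-1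

  atLeast-1≤size : size (atLeast 1 G) ≤ size G
  atLeast-1≤size = length-filter (λ g → 1 ≤? ∣ g ∣) (members G)

  n+[n∸k]≤size : n + (n ∸ k) ≤ size G
  n+[n∸k]≤size = ≤-trans n+[n∸k]≤atLeast-1 atLeast-1≤size

  -- The singletons and the members of size at least 2 already number at least `n + (n ∸ k)`. At
  -- this size they exhaust `G`, so the empty set is not a member, and there are exactly `n ∸ k`
  -- large members, which is the case where they must be disjoint.
  smallest-shape : size G ≤ n + (n ∸ k) →
    ∃ λ F → ConsistsOfSingletonsAnd G F × length F ≡ n ∸ k × AllPairs Disjoint F × All (λ f → 2 ≤ ∣ f ∣) F
  smallest-shape sz = largeMembers ,
    unique-⊆-full⇒↭ singletons-++-largeMembers-unique
      (λ g∈ → proj₁ (∈-filter⁻ (λ g → 1 ≤? ∣ g ∣) {xs = members G} (singletons-++-largeMembers-⊆ g∈)))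
      (≤-trans sz (≤-trans (+-monoʳ-≤ n n∸k≤largeMembers) (≤-reflexive (sym (length-singletons-++ largeMembers))))) ,
    ≤-antisym few n∸k≤largeMembers , few-large⇒disjoint few , largeMembers-size
    where
    few : length largeMembers ≤ n ∸ k
    few = +-cancelˡ-≤ n _ _ (≤-trans n+largeMembers≤atLeast-1 (≤-trans atLeast-1≤size sz))

  1≤containing : ∀ x → 1 ≤ size (containing x G)
  1≤containing x = unique-⊆⇒length-≤ {xs = [ ⁅ x ⁆ ]} ([] ∷ [])
    λ { (here refl) → ∈-filter⁺ (x ∈?_) (⁅x⁆∈generator x) (x∈⁅x⁆ x) }

  -- As `n ∸ k` is positive there is a member of size at least 2, and each of its points also lies
  -- in its own singleton.
  2≤containing : k < n → ∃[ x ] 2 ≤ size (containing x G)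
  2≤containing k<n with length>0⇒∃∈ largeMembers (<-≤-trans (m<n⇒0<n∸m k<n) n∸k≤largeMembers)
  ... | h , h∈ with ∈-filter⁻ (λ g → 2 ≤? ∣ g ∣) {xs = members G} h∈ | All.lookup largeMembers-nonempty h∈
  ... | h∈G , 2≤h | x , x∈h = x ,
    unique-⊆⇒length-≤ {xs = ⁅ x ⁆ ∷ h ∷ []} ((⁅x⁆≢large 2≤h ∷ []) ∷ [] ∷ [])
      λ { (here refl)         → ∈-filter⁺ (x ∈?_) (⁅x⁆∈generator x) (x∈⁅x⁆ x)
        ; (there (here refl)) → ∈-filter⁺ (x ∈?_) h∈G x∈h }

-- Ceilings

-- The numerator `suc m + (k ∸ 1)` equals `m + k`, which exceeds `m` by one full divisor.
⌈1+m/k⌉≡1+m/k : ∀ m k .{{_ : NonZero k}} → ⌈ suc m / k ⌉ ≡ suc (m / k)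
⌈1+m/k⌉≡1+m/k m k@(suc j) = trans (cong (_/ k) (sym (+-suc m j)))
  (trans (m/n≡1+[m∸n]/n (m≤n+m k m)) (cong (λ x → suc (x / k)) (m+n∸n≡m m k)))

⌈n/k⌉≡1 : ∀ {n k} .{{_ : NonZero k}} → 1 ≤ n → n ≤ k → ⌈ n / k ⌉ ≡ 1
⌈n/k⌉≡1 {suc m} {k} _ m<k = trans (⌈1+m/k⌉≡1+m/k m k) (cong suc (m<n⇒m/n≡0 m<k))

⌈n/k⌉≡2 : ∀ {n k} .{{_ : NonZero k}} → k < n → n ≤ 2 * k → ⌈ n / k ⌉ ≡ 2
⌈n/k⌉≡2 {suc m} {k} k<n n≤2k = trans (⌈1+m/k⌉≡1+m/k m k) (cong suc
  (trans (m/n≡1+[m∸n]/n k≤m) (cong suc (m<n⇒m/n≡0 m∸k<k))))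
  where
  k≤m : k ≤ m
  k≤m = s≤s⁻¹ k<n
  m∸k<k : m ∸ k < k
  m∸k<k = ≤-trans (≤-reflexive (sym (+-∸-assoc 1 k≤m)))
    (m≤n+o⇒m∸n≤o (suc m) k (≤-trans n≤2k (≤-reflexive (cong (k +_) (+-identityʳ k)))))

-- The construction

∈-allSubsets : ∀ {n} (s : Subset n) → s ∈ˡ allSubsets n
∈-allSubsets []                  = here refl
∈-allSubsets (true ∷ s)          = ∈-++⁺ˡ (∈-map⁺ (inside V.∷_) (∈-allSubsets s))
∈-allSubsets {suc n} (false ∷ s) = ∈-++⁺ʳ (map (inside V.∷_) (allSubsets n)) (∈-map⁺ (outside V.∷_) (∈-allSubsets s))

⋃-nonempty : ∀ {n} (gs : List (Subset n)) → ⋃ (filter nonempty? gs) ≡ ⋃ gs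
⋃-nonempty []       = refl
⋃-nonempty (g ∷ gs) with nonempty? g
... | yes _ = cong (g ∪_) (⋃-nonempty gs)
... | no  e = trans (⋃-nonempty gs) (sym (trans (cong (_∪ ⋃ gs) (Empty-unique e)) (∪-identityˡ (⋃ gs))))

⋃-∩ : ∀ {n} (s : Subset n) vs → ⋃ (map (s ∩_) vs) ≡ s ∩ ⋃ vs
⋃-∩ s []       = sym (∩-zeroʳ s)
⋃-∩ s (v ∷ vs) = trans (cong ((s ∩ v) ∪_) (⋃-∩ s vs)) (sym (∩-distribˡ-∪ s v (⋃ vs)))

module _ {n k : ℕ} .{{_ : NonZero k}} {V : Vec (Subset n) k} (bal : IsBalancedPartition k V) where

  open IsBalancedPartition bal

  private
    inConstr? : Decidable (λ g → Nonempty g × VAny.Any (g ⊆_) V)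
    inConstr? g = nonempty? g ×-dec VAny.any? (g ⊆?_) V

    large? : Decidable (λ (g : Subset n) → 2 ≤ ∣ g ∣)
    large? g = 2 ≤? ∣ g ∣

  -- The set `s` is cut along the parts into the pieces `s ∩ v`. Empty pieces are dropped, because
  -- `Constr V` omits the empty set.
  Constr-generates : IsGenerator k (Constr V)
  Constr-generates s _ = gs , members-Constr , few , pairwise ,
    trans (⋃-nonempty (map (s ∩_) (toList V)))
      (trans (⋃-∩ s (toList V)) (trans (cong (s ∩_) covers) (∩-identityʳ s)))
    where
    gs : List (Subset n)
    gs = filter nonempty? (map (s ∩_) (toList V))
    members-Constr : All (_∈ˡ members (Constr V)) gs
    members-Constr = All.tabulate λ g∈ → case-member (∈-filter⁻ nonempty? {xs = map (s ∩_) (toList V)} g∈)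
      where
      case-member : ∀ {g} → g ∈ˡ map (s ∩_) (toList V) × Nonempty g → g ∈ˡ members (Constr V)
      case-member (g∈ , ne) with ∈-map⁻ (s ∩_) g∈
      ... | v , v∈ , refl = ∈-filter⁺ inConstr? (∈-allSubsets (s ∩ v))
        (ne , VAnyP.toList⁻ (lose {P = (s ∩ v) ⊆_} v∈ (p∩q⊆q s v)))
    few : length gs ≤ k
    few = ≤-trans (length-filter nonempty? (map (s ∩_) (toList V)))
      (≤-reflexive (trans (length-map (s ∩_) (toList V)) (length-toList V)))
    pairwise : AllPairs Disjoint gs
    pairwise = AllPairsP.filter⁺ nonempty? (AllPairsP.map⁺ (AllPairs.map
      (λ {p} {q} d (x , x∈) → let a , b = x∈p∩q⁻ (s ∩ p) (s ∩ q) x∈ in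
        d (x , x∈p∩q⁺ (p∩q⊆q s p a , p∩q⊆q s q b)))
      (toList-AllPairs disjoint)))

  module _ (1≤n : 1 ≤ n) (n≤2k : n ≤ 2 * k) where

    private
      largeParts : List (Subset n)
      largeParts = filter large? (toList V)

      -- The two counts of a balanced partition add up to at least `k`, so every part has one of the
      -- two prescribed sizes.
      part-sizes : VAll.All (λ v → ∣ v ∣ ≤ ⌈ n / k ⌉) V
      part-sizes = VAllP.map⁻ (VAll.map bound (count-full⇒All (_≟ ⌈ n / k ⌉ ∸ 1) (_≟ ⌈ n / k ⌉) exclusive (V.map ∣_∣ V)
        (≤-trans (m≤n+m∸n k (defect n k)) (≤-reflexive (sym (cong₂ _+_ small large))))))
        where
        -- With ceiling 0, truncated subtraction would make the two prescribed sizes equal, and a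
        -- part could be counted twice.
        0<⌈n/k⌉ : 0 < ⌈ n / k ⌉
        0<⌈n/k⌉ with n ≤? k
        ... | yes n≤k = ≤-reflexive (sym (⌈n/k⌉≡1 1≤n n≤k))
        ... | no  n≰k = ≤-trans (n≤1+n 1) (≤-reflexive (sym (⌈n/k⌉≡2 (≰⇒> n≰k) n≤2k)))
        exclusive : ∀ {x} → x ≡ ⌈ n / k ⌉ ∸ 1 → x ≢ ⌈ n / k ⌉
        exclusive eq eq′ = <⇒≢ (∸-monoʳ-< {⌈ n / k ⌉} {1} {0} (s≤s z≤n) 0<⌈n/k⌉) (trans (sym eq) eq′)
        bound : ∀ {x} → x ≡ ⌈ n / k ⌉ ∸ 1 ⊎ x ≡ ⌈ n / k ⌉ → x ≤ ⌈ n / k ⌉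
        bound (inj₁ refl) = m∸n≤m ⌈ n / k ⌉ 1
        bound (inj₂ refl) = ≤-refl

      part-sizes≤2 : VAll.All (λ v → ∣ v ∣ ≤ 2) V
      part-sizes≤2 = VAll.map (λ le → ≤-trans le ⌈n/k⌉≤2) part-sizes
        where
        ⌈n/k⌉≤2 : ⌈ n / k ⌉ ≤ 2
        ⌈n/k⌉≤2 with n ≤? k
        ... | yes n≤k = ≤-trans (≤-reflexive (⌈n/k⌉≡1 1≤n n≤k)) (n≤1+n 1)
        ... | no  n≰k = ≤-reflexive (⌈n/k⌉≡2 (≰⇒> n≰k) n≤2k)

      -- If the ceiling is 1, no part is large. If it is 2, the large parts are those of size
      -- exactly 2, and there are `k - (2k - n) = n - k` of them.
      largeParts≤n∸k : length largeParts ≤ n ∸ k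
      largeParts≤n∸k with n ≤? k
      ... | yes n≤k = ≤-trans (≤-reflexive (cong length (filter-none large? (VAllP.toList⁺
              (VAll.map (λ le 2≤ → contradiction (≤-trans 2≤ (≤-trans le (≤-reflexive (⌈n/k⌉≡1 1≤n n≤k)))) (<⇒≱ ≤-refl))
              part-sizes))))) z≤n
      ... | no  n≰k = begin
        length largeParts                     ≤⟨ length-filter≤count large? (_≟ ⌈ n / k ⌉) ∣_∣
                                                   (VAll.map (λ le 2≤ → ≤-antisym le (≤-trans (≤-reflexive p≡2) 2≤)) part-sizes) ⟩
        count (_≟ ⌈ n / k ⌉) (V.map ∣_∣ V)     ≡⟨ large ⟩
        k ∸ (⌈ n / k ⌉ * k ∸ n)                ≡⟨ cong (λ p → k ∸ (p * k ∸ n)) p≡2 ⟩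
        k ∸ (2 * k ∸ n)                       ≤⟨ m≤n+o⇒m∸n≤o k (2 * k ∸ n) k≤ ⟩
        n ∸ k                                 ∎
        where
        open ≤-Reasoning
        p≡2 : ⌈ n / k ⌉ ≡ 2
        p≡2 = ⌈n/k⌉≡2 (≰⇒> n≰k) n≤2k
        k≤ : k ≤ (2 * k ∸ n) + (n ∸ k)
        -- Adding `k` to both sides lets each truncated difference be undone by its own subtrahend.
        k≤ = +-cancelʳ-≤ k _ _ (begin
          k + k                          ≡⟨ cong (k +_) (+-identityʳ k) ⟨
          2 * k                          ≡⟨ m∸n+n≡m n≤2k ⟨
          (2 * k ∸ n) + n                ≡⟨ cong ((2 * k ∸ n) +_) (m∸n+n≡m (<⇒≤ (≰⇒> n≰k))) ⟨
          (2 * k ∸ n) + (n ∸ k + k)      ≡⟨ +-assoc (2 * k ∸ n) (n ∸ k) k ⟨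
          (2 * k ∸ n) + (n ∸ k) + k      ∎)

      large∈largeParts : ∀ {g} → VAny.Any (g ⊆_) V → 2 ≤ ∣ g ∣ → g ∈ˡ largeParts
      large∈largeParts {g} g⊆part 2≤ = ∈-filter⁺ large? (go part-sizes≤2 g⊆part) 2≤
        where
        go : ∀ {m} {vs : Vec (Subset n) m} → VAll.All (λ v → ∣ v ∣ ≤ 2) vs → VAny.Any (g ⊆_) vs → g ∈ˡ toList vs
        go (v≤2 ∷ _) (VAny.here g⊆v) = here (⊆∧∣∣≥⇒≡ g⊆v (≤-trans v≤2 2≤))
        go (_ ∷ vs)  (VAny.there p)  = there (go vs p)

      Constr-⊆ : members (Constr V) ⊆ˡ singletons n ++ largeParts
      Constr-⊆ {g} g∈ with ∈-filter⁻ inConstr? {xs = allSubsets n} g∈ | large? g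
      ... | _ , _ , g⊆part       | yes 2≤ = ∈-++⁺ʳ (singletons n) (large∈largeParts g⊆part 2≤)
      ... | _ , (x , x∈g) , _    | no  2≰ = ∈-++⁺ˡ (subst (_∈ˡ singletons n)
        (⊆∧∣∣≥⇒≡ (x∈p⇒⁅x⁆⊆p x∈g) (≤-trans (s≤s⁻¹ (≰⇒> 2≰)) (≤-reflexive (sym (∣⁅x⁆∣≡1 x)))))
        (∈-map⁺ ⁅_⁆ (∈-allFin x)))

    -- One inequality suffices for the exact minimum: `Constr V` itself attains `constr V`, and
    -- every generator has at least `n + (n ∸ k)` members.
    constr≤n+[n∸k] : constr V ≤ n + (n ∸ k)
    constr≤n+[n∸k] = begin
      constr V                             ≤⟨ unique-⊆⇒length-≤ (unique (Constr V)) Constr-⊆ ⟩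
      length (singletons n ++ largeParts)  ≡⟨ length-singletons-++ largeParts ⟩
      n + length largeParts                ≤⟨ +-monoʳ-≤ n largeParts≤n∸k ⟩
      n + (n ∸ k)                          ∎
      where open ≤-Reasoning

    constrAtLeast-2≤n∸k : constrAtLeast 2 V ≤ n ∸ k
    constrAtLeast-2≤n∸k = ≤-trans
      (unique-⊆⇒length-≤ (unique (atLeast 2 (Constr V))) λ g∈ →
        let g∈C , 2≤ = ∈-filter⁻ large? {xs = members (Constr V)} g∈
            _ , _ , g⊆part = ∈-filter⁻ inConstr? {xs = allSubsets n} g∈C
        in large∈largeParts g⊆part 2≤)
      largeParts≤n∸k

    constrAtLeast-minimal : ∀ G → IsGenerator k G → ∀ i → 1 ≤ i → i ≤ ⌈ n / k ⌉ → constrAtLeast i V ≤ size (atLeast i G)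
    constrAtLeast-minimal G gen 1 _ _ = ≤-trans (length-filter (λ g → 1 ≤? ∣ g ∣) (members (Constr V)))
      (≤-trans constr≤n+[n∸k] (n+[n∸k]≤atLeast-1 G (generator⇒unionGenerator G gen)))
    constrAtLeast-minimal G gen 2 _ _ = ≤-trans constrAtLeast-2≤n∸k (n∸k≤largeMembers G (generator⇒unionGenerator G gen))
    -- An index of 3 or more exceeds the ceiling, which is 1 or 2.
    constrAtLeast-minimal _ _ (suc (suc (suc i))) _ i≤p with n ≤? k
    ... | yes n≤k with s≤s () ← ≤-trans i≤p (≤-reflexive (⌈n/k⌉≡1 1≤n n≤k))
    ... | no  n≰k with s≤s (s≤s ()) ← ≤-trans i≤p (≤-reflexive (⌈n/k⌉≡2 (≰⇒> n≰k) n≤2k))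

-- Points in many members, and the four claims

-- The bound is 1 or 2 according to the ceiling. For 1 the singleton of any point is enough; for 2 a
-- point of a large member is taken.
rich-point : ∀ {n k} .{{_ : NonZero k}} → 1 ≤ n → n ≤ 2 * k → (G : Family n) → IsGenerator k G →
  ∃ λ (z : Fin n) → 2 ^ (⌈ n / k ⌉ ∸ 1) ≤ size (containing z G)
rich-point {suc m} {k} 1≤n n≤2k G gen with suc m ≤? k
... | yes n≤k rewrite ⌈n/k⌉≡1 1≤n n≤k = zero , 1≤containing G (generator⇒unionGenerator G gen) zero
... | no  n≰k rewrite ⌈n/k⌉≡2 (≰⇒> n≰k) n≤2k = 2≤containing G (generator⇒unionGenerator G gen) (≰⇒> n≰k)

theorem2 : ∀ (n k : ℕ) .{{_ : NonZero k}} → 1 ≤ n → n ≤ 2 * k →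
    (∀ (V : Vec (Subset n) k) → IsBalancedPartition k V →
    (op[ n , k ]≡ constr V) × (opt[ n , k ]≡ constr V))
    ×
    (∀ (V : Vec (Subset n) k) → IsBalancedPartition k V →
    ∀ (G : Family n) → IsGenerator k G →
    ∀ (i : ℕ) → 1 ≤ i → i ≤ ⌈ n / k ⌉ → constrAtLeast i V ≤ size (atLeast i G))
    ×
    (∀ (G : Family n) → IsGenerator k G →
    ∃ λ (z : Fin n) → 2 ^ (⌈ n / k ⌉ ∸ 1) ≤ size (containing z G))
    ×
    (∀ (G : Family n) → IsGenerator k G →
    IsOptimal k G ⇔
    (∃ λ (F : List (Subset n)) →
    ConsistsOfSingletonsAnd G F × length F ≡ n ∸ k ×
    AllPairs Disjoint F × All (λ f → 2 ≤ ∣ f ∣) F))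
theorem2 n k 1≤n n≤2k =
  -- The lower bound holds even for overlapping unions, while the construction gives disjoint ones,
  -- so both minima come from the same family and the same bound.
  (λ V bal →
    ((Constr V , generator⇒unionGenerator (Constr V) (Constr-generates bal) , refl) ,
      λ G gen → ≤-trans (constr≤n+[n∸k] bal 1≤n n≤2k) (n+[n∸k]≤size G gen)) ,
    ((Constr V , Constr-generates bal , refl) ,
      λ G gen → ≤-trans (constr≤n+[n∸k] bal 1≤n n≤2k) (n+[n∸k]≤size G (generator⇒unionGenerator G gen)))) ,
  (λ V bal → constrAtLeast-minimal bal 1≤n n≤2k) ,
  rich-point 1≤n n≤2k ,
  λ G gen → mk⇔
    -- Optimality only compares `G` with other generators, so a concrete balanced partition is
    -- needed to turn it into a numerical bound.
    (λ (_ , _ , minimal) → let V , bal = balancedPartition n k 1≤n in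
      smallest-shape G (generator⇒unionGenerator G gen)
        (≤-trans (minimal (Constr V) (Constr-generates bal)) (constr≤n+[n∸k] bal 1≤n n≤2k)))
    -- The shape fixes the size of `G` at `n + (n ∸ k)`, the lower bound for every generator.
    (λ (F , G↭ , len , _) → gen , (G , gen , refl) , λ G′ gen′ →
      ≤-trans
        (≤-reflexive (trans (↭-length G↭) (trans (length-singletons-++ F) (cong (n +_) len))))
        (n+[n∸k]≤size G′ (generator⇒unionGenerator G′ gen′)))
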